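{- Let $\{a,b,c\}$ with $a<b<c$ be a $D(4)$-triple, and let $r=\sqrt{ab+4}$, $s=\sqrt{ac+4}$, $t=\sqrt{bc+4}$. Then $r,s,t$ are the side lengths of a non-degenerate Euclidean triangle if and only if $\{a,b,c\}$ is regular and $r>b-a$.
   Context: A $D(4)$-triple is a set of three distinct positive integers such that the product of any two distinct elements, increased by $4$, is a perfect square. A $D(4)$-triple $\{a,b,c\}$ with $a<b<c$ is called regular if $c=a+b+2r$, where $r=\sqrt{ab+4}$. The numbers $r,s,t$ are positive integers with $r<s<t$, so they are the side lengths of a non-degenerate triangle exactly when $r+s>t$. -}

module Defs where

open import Data.Nat using (ℕ; _+_; _*_; _<_)
open import Data.Product using (∃-syntax; _×_)
open import Relation.Binary.PropositionalEquality using (_≡_; _≢_)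

-- r = √n.  On ℕ this relation determines r, as square roots are nonnegative.
_IsSqrtOf_ : ℕ → ℕ → Set
r IsSqrtOf n = r * r ≡ n

IsSquare : ℕ → Set
IsSquare n = ∃[ m ] m IsSqrtOf n

-- {a , b , c} as a set: no order on a , b , c is imposed here.
record IsD4Triple (a b c : ℕ) : Set where
  field
    a>0  : 0 < a
    b>0  : 0 < b
    c>0  : 0 < c
    a≢b  : a ≢ b
    a≢c  : a ≢ c
    b≢c  : b ≢ c
    ab+4 : IsSquare (a * b + 4)
    ac+4 : IsSquare (a * c + 4)
    bc+4 : IsSquare (b * c + 4)

-- Only meant for D(4)-triples listed in increasing order, a < b < c.
IsRegular : ℕ → ℕ → ℕ → Set
IsRegular a b c = ∃[ r ] (r IsSqrtOf (a * b + 4) × c ≡ a + b + 2 * r)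

-- Positive lengths x , y , z are the sides of a non-degenerate Euclidean
-- triangle: all three triangle inequalities hold strictly.
record AreTriangleSides (x y z : ℕ) : Set where
  field
    x>0   : 0 < x
    y>0   : 0 < y
    z>0   : 0 < z
    x<y+z : x < y + z
    y<x+z : y < x + z
    z<x+y : z < x + y

{-# OPTIONS --safe #-}

-- Extend the triple by d = e/2, where e = 2(a + b + c) + abc - rst is its
-- excess, so that ad + 4 = x² and bd + 4 = y² with 2x = rs - at and
-- 2y = rt - bs.  The triple is regular exactly when d = 0, and d < 0 is
-- impossible because 0 < y < x < 2 has no integer solution.  If d > 0 then
-- x < y, and
--   2(t - s - r) = ((b + r)x - (a + r)y) + 2r(y - x - 1)
--                = r(y - x - 2) + (bx - ay)
-- is nonnegative: the first form shows it when d ≤ a + b + 2r, while for larger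
-- d the gap y - x is at least 2 and the second form applies.
module Submission where

open import Defs
open import Data.Product using (_×_; _,_; ∃-syntax)
open import Function.Bundles using (_⇔_; mk⇔)

import Data.Nat as ℕ
import Data.Nat.Properties as ℕₚ
import Data.Nat.Tactic.RingSolver as ℕ-Solver
open import Data.Nat.Primality using (euclidsLemma; prime[2])
open import Data.Integer as ℤ using (ℤ; 0ℤ; 1ℤ; +_; ∣_∣; +≤+)
import Data.Integer.Properties as ℤₚ
open import Data.Integer.Divisibility.Signed using (divides; ∣ᵤ⇒∣; ∣⇒∣ᵤ)
open import Data.Integer.Tactic.RingSolver using (solve)
open import Data.List using (_∷_; [])
open import Data.Sum using (reduce)
open import Function.Base using (_∘_)
open import Relation.Binary.Definitions using (tri<; tri≈; tri>)
open import Relation.Binary.PropositionalEquality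
  using (_≡_; refl; sym; trans; cong; subst; subst₂; module ≡-Reasoning)
open import Relation.Nullary using (¬_; yes; no; contradiction)

-- Inequalities and squares of integers.

module OrderedRing where
  open import Data.Integer using (_+_; _*_; _-_; _≤_; _<_)

  -- Inequalities are certified by writing j - i (or j - i - 1, as i < j is
  -- i + 1 ≤ j) as a combination of products of nonnegative terms, up to
  -- multiples k * (u - v) of hypotheses u ≡ v.
  infixl 6 _⊕_
  infixl 7 _⊗_

  _⊕_ : ∀ {i j} → 0ℤ ≤ i → 0ℤ ≤ j → 0ℤ ≤ i + j
  _⊕_ = ℤₚ.+-mono-≤

  _⊗_ : ∀ {i j} → 0ℤ ≤ i → 0ℤ ≤ j → 0ℤ ≤ i * j
  _⊗_ {i} {j} 0≤i 0≤j =
    subst (_≤ i * j) (ℤₚ.*-zeroʳ i) (ℤₚ.*-monoˡ-≤-nonNeg i {{ℤ.nonNegative 0≤i}} 0≤j)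

  0≤+ : ∀ n → 0ℤ ≤ + n
  0≤+ n = +≤+ ℕ.z≤n

  gap≤ : ∀ {i j} → i ≤ j → 0ℤ ≤ j - i
  gap≤ = ℤₚ.i≤j⇒0≤j-i

  gap< : ∀ {i j} → i < j → 0ℤ ≤ j - (1ℤ + i)
  gap< = gap≤ ∘ ℤₚ.i<j⇒suc[i]≤j

  ≤-by : ∀ {i j n} → 0ℤ ≤ n → n ≡ j - i → i ≤ j
  ≤-by 0≤n n≡ = ℤₚ.0≤i-j⇒j≤i (subst (0ℤ ≤_) n≡ 0≤n)

  <-by : ∀ {i j n} → 0ℤ ≤ n → n ≡ j - (1ℤ + i) → i < j
  <-by 0≤n n≡ = ℤₚ.suc[i]≤j⇒i<j (≤-by 0≤n n≡)

  modulo : ∀ {u v p q} k → u ≡ v → p ≡ q + k * (u - v) → p ≡ q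
  modulo {u} {p = p} {q} k refl p≡ = begin
    p                ≡⟨ p≡ ⟩
    q + k * (u - u)  ≡⟨ solve (q ∷ k ∷ u ∷ []) ⟩
    q                ∎
    where open ≡-Reasoning

  sq-mono-≤ : ∀ {i j} → 0ℤ ≤ i → i ≤ j → i * i ≤ j * j
  sq-mono-≤ {i} {j} 0≤i i≤j =
    ≤-by (gap≤ i≤j ⊗ (gap≤ i≤j ⊕ 0≤i ⊕ 0≤i)) (solve (i ∷ j ∷ []))

  sq-cancel-< : ∀ {i j} → 0ℤ ≤ j → i * i < j * j → i < j
  sq-cancel-< 0≤j i²<j² =
    ℤₚ.≰⇒> λ j≤i → ℤₚ.<⇒≱ i²<j² (sq-mono-≤ 0≤j j≤i)

  sq-cancel-≤ : ∀ {i j} → 0ℤ ≤ j → i * i ≤ j * j → i ≤ j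
  sq-cancel-≤ {i} {j} 0≤j i²≤j² = ℤₚ.≮⇒≥ λ j<i → ℤₚ.<⇒≱ (sq-mono-< j<i) i²≤j²
    where
    sq-mono-< : j < i → j * j < i * i
    sq-mono-< j<i =
      -- With g = `i - j - 1`, the certificate is (g + 1)(g + 1 + 2j) - 1 = g² + 2g + 2jg + 2j.
      <-by (gap< j<i ⊗ gap< j<i ⊕ 0≤+ 2 ⊗ gap< j<i ⊕ 0≤+ 2 ⊗ 0≤j ⊗ gap< j<i ⊕ 0≤+ 2 ⊗ 0≤j)
        (solve (i ∷ j ∷ []))

  sq-injective : ∀ {i j} → 0ℤ ≤ i → 0ℤ ≤ j → i * i ≡ j * j → i ≡ j
  sq-injective 0≤i 0≤j i²≡j² = ℤₚ.≤-antisym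
    (sq-cancel-≤ 0≤j (ℤₚ.≤-reflexive i²≡j²))
    (sq-cancel-≤ 0≤i (ℤₚ.≤-reflexive (sym i²≡j²)))

  even-square⇒even : ∀ i {w} → i * i ≡ w * + 2 → ∃[ q ] i ≡ q * + 2
  even-square⇒even i {w} i²≡2w with ∣ᵤ⇒∣ {+ 2} {i} 2∣∣i∣
    where
    2∣∣i∣ = reduce (euclidsLemma ∣ i ∣ ∣ i ∣ prime[2]
      (subst (2 ℕ.∣_) (ℤₚ.abs-* i i) (∣⇒∣ᵤ (divides w i²≡2w))))
      where import Data.Nat.Divisibility as ℕ
  ... | divides q i≡q2 = q , i≡q2

open OrderedRing

-- Extension of a triple and the sign of its excess.

module Extension where
  open import Data.Integer using (_+_; _*_; _-_; _≤_; _<_)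

  -- The square conditions turn (rs - at)² into 2(ae + 8), so `r * s - a * t` is even and its half
  -- is `x`. Keeping `e` instead of d = e/2 avoids a proof that the excess is even.
  extend : ∀ {a b c r s t e} → 0ℤ < a → 0ℤ < b → a < c →
           0ℤ ≤ r → 0ℤ ≤ s →
           r * r ≡ a * b + + 4 → s * s ≡ a * c + + 4 → t * t ≡ b * c + + 4 →
           e ≡ + 2 * (a + b + c) + a * b * c - r * s * t →
           ∃[ x ] (x * + 2 ≡ r * s - a * t ×
                   0ℤ < x ×
                   + 2 * (x * x) ≡ a * e + + 8)
  extend {a} {b} {c} {r} {s} {t} {e} 0<a 0<b a<c 0≤r 0≤s r² s² t² e≡ =
    let x , rs-at≡2x = even-square⇒even (r * s - a * t) {a * e + + 8} [rs-at]²
    in x , sym rs-at≡2x , 0<x rs-at≡2x , 2x² {x} rs-at≡2x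
    where
    [rs-at]² : (r * s - a * t) * (r * s - a * t) ≡ (a * e + + 8) * + 2
    [rs-at]² =
      modulo (+ 0 - + 2 * a) e≡ (modulo (s * s) r² (modulo (a * b + + 4) s²
        (modulo (a * a) t² (solve (a ∷ b ∷ c ∷ r ∷ s ∷ t ∷ e ∷ [])))))
    -- The squares differ by 4ab + 4a(c - a) + 16.
    at<rs : a * t < r * s
    at<rs = sq-cancel-< (0≤r ⊗ 0≤s)
      (<-by (0≤+ 4 ⊗ gap< 0<a ⊗ gap< 0<b ⊕ 0≤+ 4 ⊗ gap< 0<a ⊕ 0≤+ 4 ⊗ gap< 0<b
             ⊕ 0≤+ 4 ⊗ gap< 0<a ⊗ gap< a<c ⊕ 0≤+ 4 ⊗ gap< 0<a ⊕ 0≤+ 4 ⊗ gap< a<c ⊕ 0≤+ 23)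
        (modulo (+ 0 - s * s) r² (modulo (+ 0 - (a * b + + 4)) s² (modulo (a * a) t²
          (solve (a ∷ b ∷ c ∷ r ∷ s ∷ t ∷ []))))))
    0<x : ∀ {x} → r * s - a * t ≡ x * + 2 → 0ℤ < x
    0<x {x} rs-at≡2x = ℤₚ.*-cancelʳ-<-nonNeg (+ 2) (<-by (gap< at<rs) (modulo 1ℤ rs-at≡2x
      (solve (a ∷ r ∷ s ∷ t ∷ x ∷ []))))
    2x² : ∀ {x} → r * s - a * t ≡ x * + 2 → + 2 * (x * x) ≡ a * e + + 8
    2x² {x} rs-at≡2x = ℤₚ.*-cancelˡ-≡ (+ 2) _ _
      (modulo (+ 0 - (r * s - a * t + x * + 2)) rs-at≡2x (modulo (+ 0 - + 2 * a) e≡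
      (modulo (s * s) r² (modulo (a * b + + 4) s² (modulo (a * a) t²
        (solve (a ∷ b ∷ c ∷ r ∷ s ∷ t ∷ e ∷ x ∷ [])))))))

  -- By `2s` and `2t`, comparing `r + s` with `t` becomes a question linear in `x` and `y`, whose
  -- squares are governed by `e`.
  module _ {a b r s t x y e : ℤ} (0<a : 0ℤ < a) (a<b : a < b)
           (0≤r : 0ℤ ≤ r) (r² : r * r ≡ a * b + + 4)
           (0<x : 0ℤ < x) (0<y : 0ℤ < y)
           (2x² : + 2 * (x * x) ≡ a * e + + 8) (2y² : + 2 * (y * y) ≡ b * e + + 8)
           (2s : r * x + a * y ≡ + 2 * s) (2t : r * y + b * x ≡ + 2 * t) where

    private
      0≤a = ℤₚ.<⇒≤ 0<a
      0<b = ℤₚ.<-trans 0<a a<b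
      0≤b = ℤₚ.<⇒≤ 0<b
      0≤x = ℤₚ.<⇒≤ 0<x
      0≤y = ℤₚ.<⇒≤ 0<y

    excess≮0 : ¬ e < 0ℤ
    excess≮0 e<0 = ℤₚ.<⇒≱ ae<0 0≤ae
      where
      y<x : y < x
      y<x = sq-cancel-< 0≤x (ℤₚ.*-cancelˡ-<-nonNeg (+ 2)
        (<-by (gap< a<b ⊗ gap< e<0 ⊕ gap< a<b ⊕ gap< e<0)
          (modulo (+ 0 - 1ℤ) 2x² (modulo 1ℤ 2y² (solve (a ∷ b ∷ e ∷ x ∷ y ∷ []))))))
      2≤x : + 2 ≤ x
      2≤x = ℤₚ.≤-trans (ℤₚ.suc-mono (ℤₚ.i<j⇒suc[i]≤j 0<y)) (ℤₚ.i<j⇒suc[i]≤j y<x)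
      0≤ae : 0ℤ ≤ a * e
      0≤ae = ≤-by (0≤+ 2 ⊗ gap≤ 2≤x ⊗ (gap≤ 2≤x ⊕ 0≤+ 4))
        (modulo 1ℤ 2x² (solve (a ∷ e ∷ x ∷ [])))
      ae<0 : a * e < 0ℤ
      ae<0 = <-by (gap< 0<a ⊗ gap< e<0 ⊕ gap< 0<a ⊕ gap< e<0) (solve (a ∷ e ∷ []))

    -- Both roots collapse to 2, so `2s` reads 2r + 2a = 2s.
    excess≡0⇒s≡a+r : e ≡ 0ℤ → s ≡ a + r
    excess≡0⇒s≡a+r e≡0 = ℤₚ.*-cancelˡ-≡ (+ 2) _ _
      (modulo (+ 0 - 1ℤ) 2s (modulo r x≡2 (modulo a y≡2
        (solve (a ∷ r ∷ s ∷ x ∷ y ∷ [])))))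
      where
      root≡2 : ∀ {k z} → 0ℤ ≤ z → + 2 * (z * z) ≡ k * e + + 8 → z ≡ + 2
      root≡2 {k} {z} 0≤z 2z² = sq-injective 0≤z (0≤+ 2) (ℤₚ.*-cancelˡ-≡ (+ 2) _ _
        (modulo 1ℤ 2z² (modulo k e≡0 (solve (k ∷ z ∷ e ∷ [])))))
      x≡2 : x ≡ + 2
      x≡2 = root≡2 {a} 0≤x 2x²
      y≡2 : y ≡ + 2
      y≡2 = root≡2 {b} 0≤y 2y²

    r+s≤t-small : 0ℤ < e → e ≤ + 2 * (a + b + + 2 * r) → r + s ≤ t
    r+s≤t-small 0<e e≤ = ℤₚ.*-cancelˡ-≤-pos (r + s) t (+ 2)
      (≤-by (gap≤ [a+r]y≤[b+r]x ⊕ 0≤+ 2 ⊗ 0≤r ⊗ gap< x<y)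
        (modulo 1ℤ 2t (modulo (+ 0 - 1ℤ) 2s
          (solve (a ∷ b ∷ r ∷ s ∷ t ∷ x ∷ y ∷ [])))))
      where
      x<y : x < y
      x<y = sq-cancel-< 0≤y (ℤₚ.*-cancelˡ-<-nonNeg (+ 2)
        (<-by (gap< a<b ⊗ gap< 0<e ⊕ gap< a<b ⊕ gap< 0<e)
          (modulo 1ℤ 2x² (modulo (+ 0 - 1ℤ) 2y² (solve (a ∷ b ∷ e ∷ x ∷ y ∷ []))))))
      -- Since r² - ab = 4, twice the difference of the squares is 4(b - a)(2(a + b + 2r) - e); this
      -- is where the threshold on `e` comes from.
      [a+r]y≤[b+r]x : (a + r) * y ≤ (b + r) * x
      [a+r]y≤[b+r]x = sq-cancel-≤ ((0≤b ⊕ 0≤r) ⊗ 0≤x)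
        (ℤₚ.*-cancelˡ-≤-pos _ _ (+ 2)
          (≤-by (0≤+ 4 ⊗ gap≤ (ℤₚ.<⇒≤ a<b) ⊗ gap≤ e≤)
            (modulo (+ 0 - (b + r) * (b + r)) 2x² (modulo ((a + r) * (a + r)) 2y²
              (modulo ((b - a) * e) r² (solve (a ∷ b ∷ r ∷ e ∷ x ∷ y ∷ [])))))))

    r+s≤t-large : 0ℤ < e → + 2 * (a + b + + 2 * r) < e → r + s ≤ t
    r+s≤t-large 0<e large = ℤₚ.*-cancelˡ-≤-pos (r + s) t (+ 2)
      (≤-by (0≤r ⊗ gap< 1+x<y ⊕ gap≤ ay≤bx)
        (modulo 1ℤ 2t (modulo (+ 0 - 1ℤ) 2s
          (solve (a ∷ b ∷ r ∷ s ∷ t ∷ x ∷ y ∷ [])))))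
      where
      0≤e = ℤₚ.<⇒≤ 0<e
      a<r : a < r
      a<r = sq-cancel-< 0≤r (<-by (0≤a ⊗ gap≤ (ℤₚ.<⇒≤ a<b) ⊕ 0≤+ 3)
        (modulo (+ 0 - 1ℤ) r² (solve (a ∷ b ∷ r ∷ []))))
      2<r : + 2 < r
      2<r = sq-cancel-< 0≤r (<-by (gap< 0<a ⊗ gap< 0<b ⊕ gap< 0<a ⊕ gap< 0<b)
        (modulo (+ 0 - 1ℤ) r² (solve (a ∷ b ∷ r ∷ []))))
      4<a+b : + 4 < a + b
      4<a+b = sq-cancel-< (0≤a ⊕ 0≤b)
        -- Here (a + b)² = (b - a)² + 4(r² - 4), and `r` is at least 3.
        (<-by (gap≤ (ℤₚ.<⇒≤ a<b) ⊗ gap≤ (ℤₚ.<⇒≤ a<b)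
               ⊕ 0≤+ 4 ⊗ gap< 2<r ⊗ (gap< 2<r ⊕ 0≤+ 6) ⊕ 0≤+ 3)
          (modulo (+ 4) r² (solve (a ∷ b ∷ r ∷ []))))
      -- Put b ≥ a + 1 and r ≥ a + 1 into e ≥ 2a + 2b + 4r + 1; the bound 23 below uses a + b ≥ 5
      -- and r ≥ 3 instead.
      8a+7≤e : + 8 * a + + 7 ≤ e
      8a+7≤e = ≤-by (gap< large ⊕ 0≤+ 2 ⊗ gap< a<b ⊕ 0≤+ 4 ⊗ gap< a<r)
        (solve (a ∷ b ∷ r ∷ e ∷ []))
      23≤e : + 23 ≤ e
      23≤e = ≤-by (gap< large ⊕ 0≤+ 2 ⊗ gap< 4<a+b ⊕ 0≤+ 4 ⊗ gap< 2<r)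
        (solve (a ∷ b ∷ r ∷ e ∷ []))
      4x<e-2 : + 4 * x < e - + 2
      4x<e-2 = sq-cancel-< (gap≤ (ℤₚ.≤-trans (+≤+ (ℕₚ.m≤m+n 2 21)) 23≤e))
        -- As 16x² = 8ae + 64, the difference (e - 2)² - 16x² is e(e - 8a - 7) + 3(e - 23) + 9.
        (<-by (0≤e ⊗ gap≤ 8a+7≤e ⊕ 0≤+ 3 ⊗ gap≤ 23≤e ⊕ 0≤+ 8)
          (modulo (+ 8) 2x² (solve (a ∷ e ∷ x ∷ []))))
      -- Twice y² - (x + 1)² is (b - a)e - 4x - 2, which is at least e - 2 - 4x.
      1+x<y : 1ℤ + x < y
      1+x<y = sq-cancel-< 0≤y (ℤₚ.*-cancelˡ-<-nonNeg (+ 2)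
        (<-by (gap< a<b ⊗ 0≤e ⊕ gap< 4x<e-2)
          (modulo 1ℤ 2x² (modulo (+ 0 - 1ℤ) 2y² (solve (a ∷ b ∷ e ∷ x ∷ y ∷ []))))))
      -- Twice the difference of the squares factors as (b - a)(abe + 8(a + b)).
      ay≤bx : a * y ≤ b * x
      ay≤bx = sq-cancel-≤ (0≤b ⊗ 0≤x) (ℤₚ.*-cancelˡ-≤-pos _ _ (+ 2)
        (≤-by ((0≤a ⊗ 0≤b ⊗ 0≤e ⊕ 0≤+ 8 ⊗ (0≤a ⊕ 0≤b)) ⊗ gap≤ (ℤₚ.<⇒≤ a<b))
          (modulo (+ 0 - b * b) 2x² (modulo (a * a) 2y²
            (solve (a ∷ b ∷ e ∷ x ∷ y ∷ []))))))

    excess>0⇒r+s≤t : 0ℤ < e → r + s ≤ t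
    excess>0⇒r+s≤t 0<e with e ℤ.≤? + 2 * (a + b + + 2 * r)
    ... | yes e≤ = r+s≤t-small 0<e e≤
    ... | no e≰ = r+s≤t-large 0<e (ℤₚ.≰⇒> e≰)

    t<r+s⇒s≡a+r : t < r + s → s ≡ a + r
    t<r+s⇒s≡a+r t<r+s with ℤₚ.<-cmp e 0ℤ
    ... | tri< e<0 _ _ = contradiction e<0 excess≮0
    ... | tri≈ _ e≡0 _ = excess≡0⇒s≡a+r e≡0
    ... | tri> _ _ 0<e = contradiction (excess>0⇒r+s≤t 0<e) (ℤₚ.<⇒≱ t<r+s)

  triangle⇒s≡a+r : ∀ {a b c r s t} → 0ℤ < a → a < b → b < c →
    0ℤ ≤ r → 0ℤ ≤ s → 0ℤ ≤ t →
    r * r ≡ a * b + + 4 → s * s ≡ a * c + + 4 → t * t ≡ b * c + + 4 →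
    t < r + s → s ≡ a + r
  triangle⇒s≡a+r {a} {b} {c} {r} {s} {t} 0<a a<b b<c 0≤r 0≤s 0≤t r² s² t² =
    -- The second extension exchanges `a` with `b` and `s` with `t`. The excess is symmetric under
    -- this, so both roots share one `e`.
    let x , 2x , 0<x , 2x² = extend 0<a 0<b (ℤₚ.<-trans a<b b<c) 0≤r 0≤s r² s² t² refl
        y , 2y , 0<y , 2y² = extend 0<b 0<a b<c 0≤r 0≤t r²′ t² s² excess-comm
    in t<r+s⇒s≡a+r 0<a a<b 0≤r r² 0<x 0<y 2x² 2y² (2s 2x 2y) (2t 2x 2y)
    where
    0<b = ℤₚ.<-trans 0<a a<b
    r²′ : r * r ≡ b * a + + 4
    r²′ = trans r² (cong (_+ + 4) (ℤₚ.*-comm a b))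
    excess-comm : + 2 * (a + b + c) + a * b * c - r * s * t
                ≡ + 2 * (b + a + c) + b * a * c - r * t * s
    excess-comm = solve (a ∷ b ∷ c ∷ r ∷ s ∷ t ∷ [])
    -- The linear system defining `x` and `y` is inverted; its determinant is r² - ab = 4 up to
    -- sign.
    2s : ∀ {x y} → x * + 2 ≡ r * s - a * t → y * + 2 ≡ r * t - b * s →
         r * x + a * y ≡ + 2 * s
    2s {x} {y} 2x 2y = ℤₚ.*-cancelʳ-≡ _ _ (+ 2)
      (modulo r 2x (modulo a 2y (modulo s r²
        (solve (a ∷ b ∷ r ∷ s ∷ t ∷ x ∷ y ∷ [])))))
    2t : ∀ {x y} → x * + 2 ≡ r * s - a * t → y * + 2 ≡ r * t - b * s →
         r * y + b * x ≡ + 2 * t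
    2t {x} {y} 2x 2y = ℤₚ.*-cancelʳ-≡ _ _ (+ 2)
      (modulo b 2x (modulo r 2y (modulo t r²
        (solve (a ∷ b ∷ r ∷ s ∷ t ∷ x ∷ y ∷ [])))))

-- Regularity over the naturals and the equivalence.

open Extension using (triangle⇒s≡a+r)
open import Data.Nat using (ℕ; _+_; _*_; _∸_; _<_; _>_)

IsSqrtOf⇒ℤ : ∀ r m n → r IsSqrtOf (m * n + 4) → + r ℤ.* + r ≡ + m ℤ.* + n ℤ.+ + 4
IsSqrtOf⇒ℤ r m n r² = begin
  + r ℤ.* + r          ≡⟨ ℤₚ.pos-* r r ⟨
  + (r * r)            ≡⟨ cong +_ r² ⟩
  + (m * n + 4)        ≡⟨ cong (ℤ._+ + 4) (ℤₚ.pos-* m n) ⟩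
  + m ℤ.* + n ℤ.+ + 4  ∎
  where open ≡-Reasoning

IsSqrtOf-unique : ∀ {m n k} → m IsSqrtOf k → n IsSqrtOf k → m ≡ n
IsSqrtOf-unique {m} {n} {k} m² n² = ℤₚ.+-injective (sq-injective (0≤+ m) (0≤+ n) (begin
  + m ℤ.* + m  ≡⟨ ℤₚ.pos-* m m ⟨
  + (m * m)    ≡⟨ cong +_ (trans m² (sym n²)) ⟩
  + (n * n)    ≡⟨ ℤₚ.pos-* n n ⟩
  + n ℤ.* + n  ∎))
  where open ≡-Reasoning

-- This makes regularity interchangeable with the linear relation `s ≡ a + r` and, after exchanging
-- `a` and `b`, lets it imply `t ≡ b + r`.
a+r-IsSqrtOf : ∀ a b {r} → r IsSqrtOf (a * b + 4) → (a + r) IsSqrtOf (a * (a + b + 2 * r) + 4)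
a+r-IsSqrtOf a b {r} r² = begin
  (a + r) * (a + r)              ≡⟨ ℕ-Solver.solve (a ∷ r ∷ []) ⟩
  a * (a + 2 * r) + r * r        ≡⟨ cong (_+_ (a * (a + 2 * r))) r² ⟩
  a * (a + 2 * r) + (a * b + 4)  ≡⟨ ℕ-Solver.solve (a ∷ b ∷ r ∷ []) ⟩
  a * (a + b + 2 * r) + 4        ∎
  where open ≡-Reasoning

module _ {a b c r s : ℕ} (r² : r IsSqrtOf (a * b + 4)) (s² : s IsSqrtOf (a * c + 4)) where

  s≡a+r⇒regular : 0 < a → s ≡ a + r → c ≡ a + b + 2 * r
  s≡a+r⇒regular 0<a refl = ℕₚ.*-cancelˡ-≡ _ _ a {{ℕ.>-nonZero 0<a}}
    (ℕₚ.+-cancelʳ-≡ 4 _ _ (trans (sym s²) (a+r-IsSqrtOf a b r²)))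

  regular⇒s≡a+r : c ≡ a + b + 2 * r → s ≡ a + r
  regular⇒s≡a+r refl = IsSqrtOf-unique s² (a+r-IsSqrtOf a b r²)

regular⇒t≡b+r : ∀ {a b c r t} → r IsSqrtOf (a * b + 4) → t IsSqrtOf (b * c + 4) →
                c ≡ a + b + 2 * r → t ≡ b + r
regular⇒t≡b+r {a} {b} {c} {r} r² t² c≡ = regular⇒s≡a+r {b} {a}
  (trans r² (cong (_+ 4) (ℕₚ.*-comm a b))) t²
  (trans c≡ (cong (_+ 2 * r) (ℕₚ.+-comm a b)))

theorem3p2 : ∀ (a b c r s t : ℕ) →
    IsD4Triple a b c → a < b → b < c →
    r IsSqrtOf (a * b + 4) → s IsSqrtOf (a * c + 4) → t IsSqrtOf (b * c + 4) →
    AreTriangleSides r s t ⇔ (IsRegular a b c × r > b ∸ a)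
theorem3p2 a b c r s t triple a<b b<c r² s² t² = mk⇔ to from
  where
  open IsD4Triple triple using (a>0)

  to : AreTriangleSides r s t → IsRegular a b c × r > b ∸ a
  to sides = (r , r² , regular) , ℕₚ.m<n+o⇒m∸n<o b a {{ℕ.>-nonZero x>0}} b<a+r
    where
    open AreTriangleSides sides
    s≡a+r : s ≡ a + r
    s≡a+r = ℤₚ.+-injective (triangle⇒s≡a+r (ℤ.+<+ a>0) (ℤ.+<+ a<b) (ℤ.+<+ b<c)
      (0≤+ r) (0≤+ s) (0≤+ t)
      (IsSqrtOf⇒ℤ r a b r²) (IsSqrtOf⇒ℤ s a c s²) (IsSqrtOf⇒ℤ t b c t²) (ℤ.+<+ z<x+y))
    regular : c ≡ a + b + 2 * r
    regular = s≡a+r⇒regular {a} {b} {c} {r} {s} r² s² a>0 s≡a+r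
    -- In a regular triple, `t < r + s` reads b + r < a + r + r.
    b<a+r : b < a + r
    b<a+r = ℕₚ.+-cancelʳ-< r b (a + r) (subst₂ _<_
      (regular⇒t≡b+r {a} {b} r² t² regular)
      (trans (cong (_+_ r) s≡a+r) (ℕₚ.+-comm r (a + r))) z<x+y)

  from : IsRegular a b c × r > b ∸ a → AreTriangleSides r s t
  from ((r′ , r′² , c≡) , b∸a<r)
    -- The root stored in `IsRegular` is identified with `r`; the sides become `r`, `a + r`,
    -- `b + r`, and every triangle inequality is linear.
    with refl ← IsSqrtOf-unique {r′} {r} r′² r²
    with refl ← regular⇒s≡a+r {a} {b} {c} {r} {s} r² s² c≡
    with refl ← regular⇒t≡b+r {a} {b} {c} {r} {t} r² t² c≡ = record
    { x>0   = r>0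
    ; y>0   = ℕₚ.<-≤-trans a>0 (ℕₚ.m≤m+n a r)
    ; z>0   = ℕₚ.<-≤-trans r>0 (ℕₚ.m≤n+m r b)
    ; x<y+z = ℕₚ.<-≤-trans (ℕₚ.m<n+m r a>0) (ℕₚ.m≤m+n (a + r) (b + r))
    ; y<x+z = ℕₚ.<-≤-trans (ℕₚ.+-monoˡ-< r a<b) (ℕₚ.m≤n+m (b + r) r)
    ; z<x+y = b+r<r+[a+r]
    }
    where
    r>0 : 0 < r
    r>0 = ℕₚ.≤-<-trans ℕ.z≤n b∸a<r
    b<a+r : b < a + r
    -- As `a < b`, the truncated difference `b ∸ a` is the true one.
    b<a+r = subst (_< a + r) (ℕₚ.m+[n∸m]≡n (ℕₚ.<⇒≤ a<b)) (ℕₚ.+-monoʳ-< a b∸a<r)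
    b+r<r+[a+r] : b + r < r + (a + r)
    b+r<r+[a+r] = subst (b + r <_) (ℕₚ.+-comm (a + r) r) (ℕₚ.+-monoˡ-< r b<a+r)
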